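{- Let $r\ge 1$ be an integer and let $G$ be a finite, simple, connected $r$-regular graph with $|V(G)|\ge 2r+2$. If $G$ admits an interval $t$-coloring for some $t\ge 1$, then every interval $t$-coloring of $G$ satisfies $t\le 2|V(G)|-5$; that is, $W(G)\le 2|V(G)|-5$.
   Context: All graphs are finite, undirected, without loops or multiple edges. An edge-coloring of a graph $G$ with colors $1,2,\ldots,t$ is called an interval $t$-coloring if for each $i\in\{1,2,\ldots,t\}$ at least one edge of $G$ receives color $i$, and for every vertex $v$ of $G$ the colors of the edges incident to $v$ are pairwise distinct and form an interval of consecutive integers. A graph is interval colorable if it has an interval $t$-coloring for some $t\ge 1$. For an interval colorable graph $G$, $W(G)$ denotes the greatest $t$ for which $G$ has an interval $t$-coloring. -}

module Defs where

open import Data.Nat using (ℕ; zero; suc; _+_; _≤_; _<_)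
open import Data.Fin using (Fin)
open import Data.Bool using (Bool; true; false)
open import Data.List using (List; length; filter; allFin)
open import Data.Product using (Σ; ∃; ∃-syntax; _×_; _,_)
open import Relation.Binary.PropositionalEquality using (_≡_; _≢_)
open import Relation.Nullary using (¬_)
open import Relation.Nullary.Decidable using (does)
open import Data.Bool.Properties using (_≟_)
open import Function.Bundles using (_⇔_)

record Graph (n : ℕ) : Set where
  field
    adj   : Fin n → Fin n → Bool
    sym   : ∀ u v → adj u v ≡ adj v u
    irrfl : ∀ v → adj v v ≡ false

open Graph public

Adj : ∀ {n} → Graph n → Fin n → Fin n → Set
Adj G u v = adj G u v ≡ true

degree : ∀ {n} → Graph n → Fin n → ℕ
degree {n} G v = length (filter (λ u → adj G v u ≟ true) (allFin n))

Regular : ∀ {n} → Graph n → ℕ → Set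
Regular G r = ∀ v → degree G v ≡ r

data Reachable {n} (G : Graph n) : Fin n → Fin n → Set where
  here : ∀ {v} → Reachable G v v
  step : ∀ {u w v} → Adj G u w → Reachable G w v → Reachable G u v

Connected : ∀ {n} → Graph n → Set
Connected G = ∀ u v → Reachable G u v

-- An edge-colouring assigns to each ordered pair a natural number; only the
-- values on edges matter, and it must be symmetric on edges.
-- Interval t-colouring with colours 1..t.
record IntervalColoring {n} (G : Graph n) (t : ℕ) : Set where
  field
    col      : Fin n → Fin n → ℕ
    col-sym  : ∀ u v → Adj G u v → col u v ≡ col v u
    col-range : ∀ u v → Adj G u v → (1 ≤ col u v) × (col u v ≤ t)
    surj     : ∀ i → 1 ≤ i → i ≤ t → ∃[ u ] ∃[ v ] (Adj G u v × col u v ≡ i)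
    proper   : ∀ v u w → Adj G v u → Adj G v w → col v u ≡ col v w → u ≡ w
    interval : ∀ v → ∃[ a ] ∀ k →
                 (∃[ u ] (Adj G v u × col v u ≡ k)) ⇔ (a ≤ k × k < a + degree G v)

{-# OPTIONS --safe #-}
-- Let a be a vertex with an edge of colour 1 and b one with an edge of colour
-- t. Follow a geodesic a = v 0, v 1, …, v L = b which at every vertex takes,
-- among the edges leading closer to b, the one of least colour, and let p i be
-- the colour of the edge v i — v (i + 1). A colour c is charged to the pair
-- (x , i mod 2), where i is the first index with i = L or c ≤ p i, and v i — x
-- has colour c; such an edge exists because p (i - 1) < c also occurs at v i.
-- Two colours charged to one pair come from v i and v (i + 2) with x halfway
-- between them, so the least choice at v i forces x = v (i + 1), and then the
-- colour at v (i + 2) is p (i + 1), which was exceeded by assumption. The pairs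
-- (v j , j mod 2) are never charged, hence t + (L + 1) ≤ 2 n, which is enough
-- when L ≥ 4. If L ≤ 3, then t ≤ 1 + (L + 1) (r - 1) already suffices.
module Submission where

open import Defs
open import Data.Nat using (ℕ; zero; suc; _≤_; _<_; _*_; _+_; _∸_; z≤n; s≤s; _≤?_; _≟_)
open import Data.Nat.Properties
open import Data.Nat.GeneralisedArithmetic using (fold)
open import Data.Nat.Tactic.RingSolver using (solve-∀)
open import Data.Fin using (Fin; toℕ; combine; join; splitAt)
open import Data.Fin.Patterns using (0F; 1F)
open import Data.Fin.Properties using (any?; toℕ-injective; toℕ<n; combine-injective; join-splitAt; injective⇒≤)
  renaming (_≟_ to _≟ᶠ_)
open import Data.Bool using (true)
open import Data.Bool.Properties using () renaming (_≟_ to _≟ᵇ_)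
open import Data.Product using (∃-syntax; _×_; _,_; proj₁; proj₂)
open import Data.Sum using (_⊎_; inj₁; inj₂)
open import Function using (_∘_)
open import Function.Bundles using (Equivalence)
open import Relation.Binary.PropositionalEquality
  using (_≡_; _≢_; refl; trans; cong; subst; module ≡-Reasoning) renaming (sym to ≡-sym)
open import Relation.Nullary using (Dec; yes; no; ¬_; contradiction)
open import Relation.Nullary.Decidable using (_×-dec_)

-- Least witnesses, parities and a counting bound

least : {P : ℕ → Set} → (∀ k → Dec (P k)) → ∀ {k} → P k →
  ∃[ m ] (P m × (∀ {j} → P j → m ≤ j))
least P? {k} Pk with P? 0
least P? {k} Pk     | yes P0 = 0 , P0 , λ _ → z≤n
least P? {zero} Pk  | no ¬P0 = contradiction Pk ¬P0
least {P} P? {suc k} Pk | no ¬P0 with least (λ j → P? (suc j)) Pk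
... | m , Pm , m-least = suc m , Pm , bound
  where
  bound : ∀ {j} → P j → suc m ≤ j
  bound {zero}  Pj = contradiction Pj ¬P0
  bound {suc j} Pj = s≤s (m-least Pj)

parity : ℕ → Fin 2
parity 0             = 0F
parity 1             = 1F
parity (suc (suc i)) = parity i

same-parity-gap : ∀ {i j} → parity i ≡ parity j → i ≤ j → j ≤ 2 + i → j ≡ i ⊎ j ≡ 2 + i
same-parity-gap {0} {0} _ _ _ = inj₁ refl
same-parity-gap {0} {1} ()
same-parity-gap {0} {2} _ _ _ = inj₂ refl
same-parity-gap {0} {suc (suc (suc _))} _ _ (s≤s (s≤s ()))
same-parity-gap {1} {1} _ _ _ = inj₁ refl
same-parity-gap {1} {2} ()
same-parity-gap {1} {3} _ _ _ = inj₂ refl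
same-parity-gap {1} {suc (suc (suc (suc _)))} _ _ (s≤s (s≤s (s≤s ())))
same-parity-gap {suc (suc i)} {suc (suc j)} eq (s≤s (s≤s i≤j)) (s≤s (s≤s j≤2+i))
  with same-parity-gap {i} {j} eq i≤j j≤2+i
... | inj₁ refl = inj₁ refl
... | inj₂ refl = inj₂ refl

adjacent-same-parity : ∀ {i j} → parity i ≡ parity j → i ≤ suc j → j ≤ suc i → i ≡ j
adjacent-same-parity {i} {j} eq i≤1+j j≤1+i with ≤-total i j
... | inj₁ i≤j with same-parity-gap eq i≤j (m≤n⇒m≤1+n j≤1+i)
...   | inj₁ j≡i  = ≡-sym j≡i
...   | inj₂ refl = contradiction j≤1+i 1+n≰n
adjacent-same-parity {i} {j} eq i≤1+j j≤1+i | inj₂ j≤i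
  with same-parity-gap (≡-sym eq) j≤i (m≤n⇒m≤1+n i≤1+j)
...   | inj₁ i≡j  = i≡j
...   | inj₂ refl = contradiction i≤1+j 1+n≰n

-- Two families are counted at once: later the `t` colours and the `L + 1` path vertices, against
-- all pairs of a vertex and a parity.
⊎-injective⇒+≤* : ∀ {k l m n} (f : Fin k ⊎ Fin l → Fin m × Fin n) →
  (∀ {x y} → f x ≡ f y → x ≡ y) → k + l ≤ m * n
⊎-injective⇒+≤* {k} {l} f f-inj = injective⇒≤ {f = λ i → pair (f (splitAt k i))} λ {i} {j} eq → begin
  i                        ≡⟨ join-splitAt k l i ⟨
  join k l (splitAt k i)   ≡⟨ cong (join k l) (f-inj (pair-inj eq)) ⟩
  join k l (splitAt k j)   ≡⟨ join-splitAt k l j ⟩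
  j                        ∎
  where
  open ≡-Reasoning
  pair : ∀ {m n} → Fin m × Fin n → Fin (m * n)
  pair (i , j) = combine i j
  pair-inj : ∀ {m n} {x y : Fin m × Fin n} → pair x ≡ pair y → x ≡ y
  pair-inj {x = i , j} {k , l} eq with combine-injective i j k l eq
  ... | refl , refl = refl

-- Walks and the distance to a fixed vertex

module _ {n} (G : Graph n) where

  Adj-sym : ∀ {u v} → Adj G u v → Adj G v u
  Adj-sym {u} {v} uv = trans (sym G v u) uv

  Adj-irrefl : ∀ {v} → ¬ Adj G v v
  Adj-irrefl {v} vv with trans (≡-sym vv) (irrfl G v)
  ... | ()

  data Walk (b : Fin n) : ℕ → Fin n → Set where
    stop : Walk b 0 b
    move : ∀ {u w k} → Adj G u w → Walk b k w → Walk b (suc k) u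

  walk? : ∀ b k u → Dec (Walk b k u)
  walk? b zero u with u ≟ᶠ b
  ... | yes refl = yes stop
  ... | no u≢b   = no λ { stop → u≢b refl }
  walk? b (suc k) u with any? (λ w → (adj G u w ≟ᵇ true) ×-dec walk? b k w)
  ... | yes (w , uw , wb) = yes (move uw wb)
  ... | no ¬walk          = no λ { (move uw wb) → ¬walk (_ , uw , wb) }

  reachable⇒walk : ∀ {u b} → Reachable G u b → ∃[ k ] Walk b k u
  reachable⇒walk here        = 0 , stop
  reachable⇒walk (step uw p) with reachable⇒walk p
  ... | k , wb = suc k , move uw wb

module Distance {n} (G : Graph n) (conn : Connected G) (b : Fin n) where

  abstract
    geodesic : ∀ u → ∃[ m ] (Walk G b m u × (∀ {j} → Walk G b j u → m ≤ j))
    geodesic u = least (λ k → walk? G b k u) (proj₂ (reachable⇒walk G (conn u b)))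

  dist : Fin n → ℕ
  dist u = proj₁ (geodesic u)

  dist-adj : ∀ {u w} → Adj G u w → dist u ≤ suc (dist w)
  dist-adj {u} {w} uw = proj₂ (proj₂ (geodesic u)) (move uw (proj₁ (proj₂ (geodesic w))))

  dist≡0⇒≡ : ∀ {u} → dist u ≡ 0 → u ≡ b
  dist≡0⇒≡ {u} eq with subst (λ k → Walk G b k u) eq (proj₁ (proj₂ (geodesic u)))
  ... | stop = refl

  -- Take the first step of a shortest walk: its tail bounds the new distance above, and `dist-adj`
  -- bounds it below.
  closer : ∀ {u k} → dist u ≡ suc k → ∃[ w ] (Adj G u w × dist w ≡ k)
  closer {u} {k} eq with subst (λ k → Walk G b k u) eq (proj₁ (proj₂ (geodesic u)))
  ... | move {w = w} uw wb = w , uw ,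
    ≤-antisym (proj₂ (proj₂ (geodesic w)) wb)
              (≤-pred (subst (_≤ suc (dist w)) eq (dist-adj uw)))

-- Colours at a vertex

module Colors {n} {G : Graph n} {t} (I : IntervalColoring G t) where
  open IntervalColoring I

  HasColor : Fin n → ℕ → Set
  HasColor v c = ∃[ u ] (Adj G v u × col v u ≡ c)

  hasColor-between : ∀ {v p q c} → HasColor v p → HasColor v q → p ≤ c → c ≤ q → HasColor v c
  hasColor-between {v} {p} {q} {c} vp vq p≤c c≤q with interval v
  ... | _ , equiv = Equivalence.from (equiv c)
    ( ≤-trans (proj₁ (Equivalence.to (equiv p) vp)) p≤c
    , ≤-<-trans c≤q (proj₂ (Equivalence.to (equiv q) vq)) )

  hasColor-span : ∀ {v p q} → HasColor v p → HasColor v q → q < p + degree G v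
  hasColor-span {v} {p} {q} vp vq with interval v
  ... | _ , equiv = <-≤-trans (proj₂ (Equivalence.to (equiv q) vq))
    (+-monoˡ-≤ (degree G v) (proj₁ (Equivalence.to (equiv p) vp)))

-- The greedy geodesic

module GreedyGeodesic {n} {G : Graph n} (conn : Connected G) {t} (I : IntervalColoring G t)
  {a b : Fin n} (a-first : Colors.HasColor I a 1) (b-last : Colors.HasColor I b t) where

  open IntervalColoring I
  open Colors I
  open Distance G conn b

  -- Vacuous at distance 0, so that every vertex has a successor and the path can be iterated over
  -- all of ℕ.
  IsNext : Fin n → Fin n → Set
  IsNext u w = ∀ {k} → dist u ≡ suc k → Adj G u w × dist w ≡ k ×
    (∀ {x} → Adj G u x → dist x ≡ k → col u w ≤ col u x)

  abstract
    next-exists : ∀ u → ∃[ w ] IsNext u w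
    next-exists u with dist u in eq
    ... | zero  = u , λ ()
    ... | suc k with closer eq
    ... | w , uw , dw
      with least (λ c → any? (λ x → (adj G u x ≟ᵇ true) ×-dec ((dist x ≟ k) ×-dec (col u x ≟ c))))
                 (w , uw , dw , refl)
    ... | _ , (x , ux , dx , refl) , x-least =
      x , λ { refl → ux , dx , λ uy dy → x-least (_ , uy , dy , refl) }

  v : ℕ → Fin n
  v = fold a (proj₁ ∘ next-exists)

  L : ℕ
  L = dist a

  p : ℕ → ℕ
  p i = col (v i) (v (suc i))

  v-next : ∀ i → IsNext (v i) (v (suc i))
  v-next i = proj₂ (next-exists (v i))

  -- Avoids truncated subtraction in "distance `L ∸ i`", and restricts `i` to at most `L`, where the
  -- sequence is still the geodesic.
  Level : ℕ → Set
  Level i = i + dist (v i) ≡ L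

  level-suc : ∀ {i k} → Level i → dist (v i) ≡ suc k → Level (suc i)
  level-suc {i} {k} lev eq = begin
    suc i + dist (v (suc i))  ≡⟨ cong (suc i +_) (proj₁ (proj₂ (v-next i eq))) ⟩
    suc i + k                 ≡⟨ +-suc i k ⟨
    i + suc k                 ≡⟨ cong (i +_) eq ⟨
    i + dist (v i)            ≡⟨ lev ⟩
    L                         ∎
    where open ≡-Reasoning

  level : ∀ {i} → i ≤ L → Level i
  level {zero}  _   = refl
  level {suc i} i<L with dist (v i) in eq
  ... | suc k = level-suc (level (<⇒≤ i<L)) eq
  ... | zero  = contradiction
    (trans (≡-sym (+-identityʳ i)) (trans (cong (i +_) (≡-sym eq)) (level (<⇒≤ i<L)))) (<⇒≢ i<L)

  -- Index and distance sum to `L` along the path, so a bound on distances turns into one on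
  -- indices.
  dist-gap⇒index-gap : ∀ {i j} m → Level i → Level j → dist (v i) ≤ m + dist (v j) → j ≤ m + i
  dist-gap⇒index-gap {i} {j} m li lj di≤m+dj = +-cancelʳ-≤ (dist (v j)) j (m + i) (begin
    j + dist (v j)        ≡⟨ trans lj (≡-sym li) ⟩
    i + dist (v i)        ≤⟨ +-monoʳ-≤ i di≤m+dj ⟩
    i + (m + dist (v j))  ≡⟨ +-assoc i m _ ⟨
    i + m + dist (v j)    ≡⟨ cong (_+ dist (v j)) (+-comm i m) ⟩
    m + i + dist (v j)    ∎)
    where open ≤-Reasoning

  v-injective : ∀ {i j} → Level i → Level j → v i ≡ v j → i ≡ j
  v-injective {i} {j} li lj eq = ≤-antisym
    (dist-gap⇒index-gap 0 lj li (≤-reflexive (cong dist (≡-sym eq))))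
    (dist-gap⇒index-gap 0 li lj (≤-reflexive (cong dist eq)))

  common-neighbour-gap : ∀ {i j x} → Level i → Level j → Adj G (v i) x → Adj G (v j) x → j ≤ 2 + i
  common-neighbour-gap li lj ix jx =
    dist-gap⇒index-gap 2 li lj (≤-trans (dist-adj ix) (s≤s (dist-adj (Adj-sym G jx))))

  -- Crossings of a colour and their charges

  hasColor-p : ∀ i {k} → dist (v i) ≡ suc k → HasColor (v i) (p i)
  hasColor-p i eq = v (suc i) , proj₁ (v-next i eq) , refl

  hasColor-p-suc : ∀ i {k} → dist (v i) ≡ suc k → HasColor (v (suc i)) (p i)
  hasColor-p-suc i eq with proj₁ (v-next i eq)
  ... | e = v i , Adj-sym G e , ≡-sym (col-sym (v i) (v (suc i)) e)

  hasColor-t : ∀ i → dist (v i) ≡ 0 → HasColor (v i) t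
  hasColor-t i eq = subst (λ u → HasColor u t) (≡-sym (dist≡0⇒≡ eq)) b-last

  -- Of "first index" only the comparison with the preceding edge is kept. `below` is vacuous at the
  -- start of the path, `above` at its end.
  record Crossing (c i : ℕ) : Set where
    field
      lev   : Level i
      below : ∀ {j} → i ≡ suc j → p j < c
      above : ∀ {k} → dist (v i) ≡ suc k → c ≤ p i
      color : HasColor (v i) c

  open Crossing

  -- Invariant: `q ≤ c` is a colour at `v i`, first 1 and then the colour of the edge just
  -- traversed. If `c ≤ p i`, the interval at `v i` contains `c`; otherwise move on with `q = p i`.
  -- At the end of the path `t` replaces `p i`.
  cross-from : ∀ {c} → c ≤ t → ∀ k i {q} → dist (v i) ≡ k → Level i →
    (∀ {j} → i ≡ suc j → p j < c) → HasColor (v i) q → q ≤ c → ∃[ i′ ] Crossing c i′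
  cross-from c≤t zero i eq li lo vq q≤c = i , record
    { lev = li ; below = lo
    ; above = λ eq′ → contradiction (trans (≡-sym eq) eq′) 0≢1+n
    ; color = hasColor-between vq (hasColor-t i eq) q≤c c≤t }
  cross-from {c} c≤t (suc k) i eq li lo vq q≤c with c ≤? p i
  ... | yes c≤pi = i , record
    { lev = li ; below = lo ; above = λ _ → c≤pi
    ; color = hasColor-between vq (hasColor-p i eq) q≤c c≤pi }
  ... | no c≰pi  = cross-from c≤t k (suc i) (proj₁ (proj₂ (v-next i eq))) (level-suc li eq)
    (λ { refl → ≰⇒> c≰pi }) (hasColor-p-suc i eq) (<⇒≤ (≰⇒> c≰pi))

  crossing : ∀ {c} → 1 ≤ c → c ≤ t → ∃[ i ] Crossing c i
  crossing 1≤c c≤t = cross-from c≤t L 0 refl refl (λ ()) a-first 1≤c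

  no-charge-two-apart : ∀ {c c′ i} (X : Crossing c i) (X′ : Crossing c′ (2 + i)) →
    proj₁ (color X) ≢ proj₁ (color X′)
  no-charge-two-apart {c} {c′} {i} X X′ refl = contradiction p[1+i]≡c′ (<⇒≢ (below X′ refl))
    where
    x   = proj₁ (color X)
    ix  = proj₁ (proj₂ (color X))
    jx  = proj₁ (proj₂ (color X′))
    k   = dist (v (2 + i))

    dist-vi : dist (v i) ≡ 2 + k
    dist-vi = +-cancelˡ-≡ i _ _ (trans (lev X) (trans (≡-sym (lev X′))
      (trans (≡-sym (+-suc (suc i) k)) (≡-sym (+-suc i (suc k))))))

    -- Lying between distances `k` and `2 + k`, `x` competes with `v (suc i)` in the greedy choice
    -- at `v i`.
    dist-x : dist x ≡ suc k
    dist-x = ≤-antisym (dist-adj (Adj-sym G jx))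
      (≤-pred (subst (_≤ suc (dist x)) dist-vi (dist-adj ix)))

    c≡p : col (v i) x ≡ p i
    c≡p = ≤-antisym (subst (_≤ p i) (≡-sym (proj₂ (proj₂ (color X)))) (above X dist-vi))
      (proj₂ (proj₂ (v-next i dist-vi)) ix dist-x)

    x≡v : x ≡ v (suc i)
    x≡v = proper (v i) x (v (suc i)) ix (proj₁ (v-next i dist-vi)) c≡p

    p[1+i]≡c′ : p (suc i) ≡ c′
    p[1+i]≡c′ = trans (≡-sym (trans (cong (col (v (2 + i))) x≡v)
        (col-sym (v (2 + i)) (v (suc i)) (subst (Adj G (v (2 + i))) x≡v jx))))
      (proj₂ (proj₂ (color X′)))

  -- A common neighbour and equal parity leave index gap 0 or 2. With gap 0, both colours are that
  -- of the single edge from `v i` to `x`.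
  charge-injective-≤ : ∀ {c c′ i i′} (X : Crossing c i) (X′ : Crossing c′ i′) → i ≤ i′ →
    proj₁ (color X) ≡ proj₁ (color X′) → parity i ≡ parity i′ → c ≡ c′
  charge-injective-≤ {i = i} X X′ i≤i′ x≡ par
    with same-parity-gap par i≤i′ (common-neighbour-gap (lev X) (lev X′)
           (proj₁ (proj₂ (color X))) (subst (Adj G _) (≡-sym x≡) (proj₁ (proj₂ (color X′)))))
  ... | inj₁ refl = trans (≡-sym (proj₂ (proj₂ (color X))))
    (trans (cong (col (v i)) x≡) (proj₂ (proj₂ (color X′))))
  ... | inj₂ refl = contradiction x≡ (no-charge-two-apart X X′)

  charge-injective : ∀ {c c′ i i′} (X : Crossing c i) (X′ : Crossing c′ i′) →
    proj₁ (color X) ≡ proj₁ (color X′) → parity i ≡ parity i′ → c ≡ c′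
  charge-injective {i = i} {i′} X X′ x≡ par with ≤-total i i′
  ... | inj₁ i≤i′ = charge-injective-≤ X X′ i≤i′ x≡ par
  ... | inj₂ i′≤i = ≡-sym (charge-injective-≤ X′ X i′≤i (≡-sym x≡) (≡-sym par))

  -- Otherwise `v i` and `v j` are adjacent, so their indices differ by at most 1; equal parity then
  -- gives a loop.
  path-uncharged : ∀ {c i j} (X : Crossing c i) → Level j →
    proj₁ (color X) ≡ v j → parity i ≢ parity j
  path-uncharged {i = i} {j} X lj x≡ par = Adj-irrefl G (subst (λ k → Adj G (v i) (v k)) (≡-sym i≡j) ij)
    where
    ij : Adj G (v i) (v j)
    ij = subst (Adj G (v i)) x≡ (proj₁ (proj₂ (color X)))
    i≡j : i ≡ j
    i≡j = adjacent-same-parity par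
      (dist-gap⇒index-gap 1 lj (lev X) (dist-adj (Adj-sym G ij)))
      (dist-gap⇒index-gap 1 (lev X) lj (dist-adj ij))

  charge : Fin t ⊎ Fin (suc L) → Fin n × Fin 2
  charge (inj₁ c) with crossing {suc (toℕ c)} (s≤s z≤n) (toℕ<n c)
  -- `Fin t` starts at 0, so its element `c` stands for the colour `suc (toℕ c)`.
  ... | i , X = proj₁ (color X) , parity i
  charge (inj₂ j) = v (toℕ j) , parity (toℕ j)

  charge-inj : ∀ {x y} → charge x ≡ charge y → x ≡ y
  charge-inj {inj₁ c} {inj₁ c′} eq = cong inj₁ (toℕ-injective (suc-injective
    (charge-injective (proj₂ (crossing _ (toℕ<n c))) (proj₂ (crossing _ (toℕ<n c′)))
      (cong proj₁ eq) (cong proj₂ eq))))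
  charge-inj {inj₁ c} {inj₂ j} eq = contradiction (cong proj₂ eq)
    (path-uncharged (proj₂ (crossing _ (toℕ<n c))) (level (≤-pred (toℕ<n j))) (cong proj₁ eq))
  charge-inj {inj₂ j} {inj₁ c} eq = contradiction (≡-sym (cong proj₂ eq))
    (path-uncharged (proj₂ (crossing _ (toℕ<n c))) (level (≤-pred (toℕ<n j))) (≡-sym (cong proj₁ eq)))
  charge-inj {inj₂ j} {inj₂ j′} eq = cong inj₂ (toℕ-injective
    (v-injective (level (≤-pred (toℕ<n j))) (level (≤-pred (toℕ<n j′))) (cong proj₁ eq)))

  t+length≤2n : t + suc L ≤ n * 2
  t+length≤2n = ⊎-injective⇒+≤* charge charge-inj

  -- The bound for short geodesics

  module _ {r} (reg : Regular G (suc r)) where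

    hasColor-step : ∀ {u q q′} → HasColor u q → HasColor u q′ → q′ ≤ r + q
    hasColor-step {u} {q} {q′} uq uq′ = ≤-pred (begin-strict
      q′                <⟨ hasColor-span uq uq′ ⟩
      q + degree G u    ≡⟨ cong (q +_) (reg u) ⟩
      q + suc r         ≡⟨ +-comm q (suc r) ⟩
      suc r + q         ∎)
      where open ≤-Reasoning

    -- At degree `suc r` two colours at one vertex differ by at most `r`, and consecutive path
    -- vertices share an edge colour. Each of the `suc k` remaining vertices thus adds at most `r`.
    t≤-from : ∀ k i {q} → dist (v i) ≡ k → HasColor (v i) q → t ≤ suc k * r + q
    t≤-from zero i {q} eq vq = subst (λ s → t ≤ s + q) (≡-sym (+-identityʳ r))
      (hasColor-step vq (hasColor-t i eq))
    t≤-from (suc k) i {q} eq vq = begin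
      t                        ≤⟨ t≤-from k (suc i) (proj₁ (proj₂ (v-next i eq))) (hasColor-p-suc i eq) ⟩
      suc k * r + p i          ≤⟨ +-monoʳ-≤ (suc k * r) (hasColor-step vq (hasColor-p i eq)) ⟩
      suc k * r + (r + q)      ≡⟨ +-assoc (suc k * r) r q ⟨
      suc k * r + r + q        ≡⟨ cong (_+ q) (+-comm (suc k * r) r) ⟩
      suc (suc k) * r + q      ∎
      where open ≤-Reasoning

    t≤span : t ≤ suc L * r + 1
    t≤span = t≤-from L 0 refl a-first

theorem7 : (r n : ℕ) → 1 ≤ r → (G : Graph n) → Connected G → Regular G r →
    2 * r + 2 ≤ n → (t : ℕ) → 1 ≤ t → IntervalColoring G t → t ≤ 2 * n ∸ 5
theorem7 (suc r) n _ G conn reg 2r+2≤n t 1≤t I = m+n≤o⇒m≤o∸n t t+5≤2n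
  where
  open IntervalColoring I
  open ≤-Reasoning
  first = surj 1 ≤-refl 1≤t
  last  = surj t 1≤t ≤-refl
  open GreedyGeodesic conn I (proj₂ first) (proj₂ last)

  t+5≤2n : t + 5 ≤ 2 * n
  t+5≤2n with 4 ≤? L
  -- The 5 is the least possible number of path vertices here.
  ... | yes 4≤L = begin
    t + 5      ≤⟨ +-monoʳ-≤ t (s≤s 4≤L) ⟩
    t + suc L  ≤⟨ t+length≤2n ⟩
    n * 2      ≡⟨ *-comm n 2 ⟩
    2 * n      ∎
  ... | no 4≰L = begin
    t + 5                  ≤⟨ +-monoˡ-≤ 5 (t≤span reg) ⟩
    suc L * r + 1 + 5      ≤⟨ +-monoˡ-≤ 5 (+-monoˡ-≤ 1 (*-monoˡ-≤ r (≰⇒> 4≰L))) ⟩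
    -- The degree is `suc r`, so `2 * n` is at least `4 * r + 8`, which exceeds the required
    -- `4 * r + 6` by 2.
    4 * r + 1 + 5          ≤⟨ m≤m+n _ 2 ⟩
    4 * r + 1 + 5 + 2      ≡⟨ identity r ⟩
    2 * (2 * suc r + 2)    ≤⟨ *-monoʳ-≤ 2 2r+2≤n ⟩
    2 * n                  ∎
    where
    identity : ∀ r → 4 * r + 1 + 5 + 2 ≡ 2 * (2 * suc r + 2)
    identity = solve-∀
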